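{- Let $k, m, n$ be integers with $5 \leq k \leq m$ and $$\binom{m}{k-2} - (m-k+1)A(m,4,k-3) \leq n \leq \binom{m}{k-2},$$ and let $\rho = \left(\binom{m}{k-2} - n\right) \bmod (m-k+1)$. If $0 \leq \rho < \frac{m-k+1}{2}$, then $$N(n,k,m) = n(k-2) - \left\lfloor \frac{2\left(\binom{m}{k-2} - n\right)}{m-k+1} \right\rfloor.$$ If $\frac{m-k+1}{2} \leq \rho < m-k+1$, then $$N(n,k,m) \leq n(k-2) - 2\left\lfloor \frac{\binom{m}{k-2} - n}{m-k+1} \right\rfloor.$$
   Context: An $(n, N, k, m)$-CBC is a pair $(\mathcal{S}, \mathcal{X})$ where $\mathcal{S}$ is a set of $m$ elements and $\mathcal{X} = (X_1, \ldots, X_n)$ is a list (repetitions allowed) of $n$ subsets of $\mathcal{S}$ with $\sum_{j=1}^n |X_j| = N$, such that for every choice of $r$ distinct indices $i_1, \ldots, i_r$ with $1 \leq r \leq k$ one has $|X_{i_1} \cup \cdots \cup X_{i_r}| \geq r$. $N(n,k,m)$ denotes the minimum $N$ for which an $(n, N, k, m)$-CBC exists. $A(m, 2d, w)$ denotes the maximum number of codewords in a binary constant weight code of length $m$, weight $w$ and minimum Hamming distance $2d$, i.e., the maximum size of a family of $w$-subsets of an $m$-set any two of which have symmetric difference of size at least $2d$. -}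

module Defs where

open import Data.Nat using (ℕ; _≤_; _+_)
open import Data.Fin using (Fin)
open import Data.Fin.Subset using (Subset; ∣_∣; ⋃; _∪_; _─_)
open import Data.Fin.Subset.Properties using (_∈?_)
open import Data.List using (List; map; filter; allFin)
open import Data.Nat.ListAction using (sum)
open import Data.Product using (Σ; ∃; _×_)
open import Relation.Binary.PropositionalEquality using (_≡_)
open import Relation.Nullary using (¬_)

-- The ground set 𝒮 is Fin m; a list 𝒳 = (X_1,…,X_n) of subsets is a
-- function Fin n → Subset m (repetitions allowed).

unionOver : {n m : ℕ} → Subset n → (Fin n → Subset m) → Subset m
unionOver {n} I X = ⋃ (map X (filter (_∈? I) (allFin n)))

totalSize : {n m : ℕ} → (Fin n → Subset m) → ℕ
totalSize {n} X = sum (map (λ j → ∣ X j ∣) (allFin n))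

IsCBC : (n k m : ℕ) → (Fin n → Subset m) → Set
IsCBC n k m X = (I : Subset n) → 1 ≤ ∣ I ∣ → ∣ I ∣ ≤ k → ∣ I ∣ ≤ ∣ unionOver I X ∣

CBCExists : (n N k m : ℕ) → Set
CBCExists n N k m = Σ (Fin n → Subset m) λ X → IsCBC n k m X × totalSize X ≡ N

NValue : (n k m v : ℕ) → Set
NValue n k m v = CBCExists n v k m × (∀ N → CBCExists n N k m → v ≤ N)

NAtMost : (n k m b : ℕ) → Set
NAtMost n k m b = ∃ λ N → CBCExists n N k m × N ≤ b

dist : {m : ℕ} → Subset m → Subset m → ℕ
dist p q = ∣ (p ─ q) ∪ (q ─ p) ∣

IsCWCode : (m d w a : ℕ) → (Fin a → Subset m) → Set
IsCWCode m d w a C =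
  (∀ i → ∣ C i ∣ ≡ w) × (∀ i j → ¬ (i ≡ j) → d ≤ dist (C i) (C j))

-- A(m, d, w) = a  (d is the minimum distance, i.e. "2d" in the paper)
AValue : (m d w a : ℕ) → Set
AValue m d w a =
  (Σ (Fin a → Subset m) (IsCWCode m d w a)) ×
  (∀ b → Σ (Fin b → Subset m) (IsCWCode m d w b) → b ≤ a)

{-# OPTIONS --safe #-}
module Submission where

-- A family is a batch code iff every S with ∣S∣ < k contains at most ∣S∣ of its members.
--
-- Lower bound. Count pairs (X j, T) with X j ⊆ T and ∣T∣ = k − 1.  There are at most
-- (k−1) C(m,k−1) of them, and a member of size i lies in C(m−i, k−1−i) such T, which with
-- L = m − k + 1 is at least (L+1)(2 + L(k−2−i))/2.  Hence ∑ⱼ (2 + L(k−2−∣X j∣)) ≤ 2 C(m,k−2).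
--
-- Upper bound. Start from all (k−2)-sets.  For each of t = ⌊(C(m,k−2) − n)/L⌋ codewords of weight
-- k−3 remove its L+2 supersets of size k−2 and add the codeword twice.  Distance 4 means that no
-- (k−2)-set contains two codewords, so inside a (k−1)-set each codeword added twice pays for
-- exactly two removed sets, and the count stays k − 1.

open import Defs
open import Data.Bool using (true; false; if_then_else_)
open import Data.Fin using (Fin; zero; suc; inject≤) renaming (_≟_ to _≟ᶠ_)
open import Data.Fin.Properties using (inject≤-injective; suc-injective)
open import Data.Fin.Subset using (Subset; inside; outside; ⊤; ⊥; ∣_∣; ⋃; _⊆_; _∈_)
open import Data.Fin.Subset.Properties using (_⊆?_; _∈?_; ⊆-trans; drop-∷-⊆; s⊆s; p⊆q⇒∣p∣≤∣q∣; ⊆-max; ⊆-min; ∣⊥∣≡0; ∣⊤∣≡n; p⊆p∪q; q⊆p∪q; x∈p∪q⁻; ∉⊥)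
open import Data.List using (List; []; _∷_; _++_; map; filter; take; allFin; length; lookup)
open import Data.List.Properties using (map-tabulate; tabulate-lookup; map-++; map-cong; map-∘; length-++; length-map; length-tabulate; length-take)
open import Data.List.Membership.Propositional renaming (_∈_ to _∈ₗ_) using ()
open import Data.List.Membership.Propositional.Properties using (∈-filter⁻; ∈-filter⁺; ∈-map⁻; ∈-map⁺; ∈-allFin)
open import Data.List.Relation.Unary.All using (All; []; _∷_; universal) renaming (map to All-map)
open import Data.List.Relation.Unary.All.Properties using (all-filter; take⁺; tabulate⁺)
open import Data.List.Relation.Unary.Any using (here; there)
open import Data.Nat using (ℕ; _+_; _*_; _∸_; _≤_; _<_; _/_; _%_; zero; suc; z≤n; s≤s; s≤s⁻¹; _≟_; _≤?_; _<?_)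
open import Data.Nat.Combinatorics using (_C_; nCk+nC[k+1]≡[n+1]C[k+1]; nCn≡1; nC1≡n; nCk≡nC[n∸k]; k>n⇒nCk≡0)
open import Data.Nat.DivMod using (m≡m%n+[m/n]*n; m%n<n; /-monoˡ-≤; m*n/n≡m; m<n⇒m/n≡0; +-distrib-/-∣ʳ)
open import Data.Nat.Divisibility using (divides-refl)
open import Data.Nat.ListAction using (sum)
open import Data.Nat.ListAction.Properties using (sum-++)
open import Data.Nat.Properties hiding (suc-injective)
open import Data.Nat.Tactic.RingSolver using (solve-∀)
open import Data.Product using (_×_; _,_; proj₁; proj₂; ∃)
open import Data.Sum using (inj₁; inj₂; [_,_]′)
open import Data.Vec using ([]; _∷_; here; there) renaming (tabulate to tabulateᵥ)
open import Data.Vec.Properties using (lookup∘tabulate; lookup⇒[]=; []=⇒lookup)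
open import Function using (_∘_; id)
open import Relation.Binary.Definitions using (tri<; tri≈; tri>)
open import Relation.Binary.PropositionalEquality using (_≡_; refl; sym; trans; cong; cong₂; subst; subst₂; module ≡-Reasoning)
open import Relation.Nullary using (Dec; yes; no; does; ¬_; contradiction)
open import Relation.Nullary.Decidable using (_×-dec_; dec-true; dec-false)
open import Relation.Unary using (Decidable)

private
  variable
    A B : Set
    P Q : Set
    m n k : ℕ

-- Sums over lists

∑ : List A → (A → ℕ) → ℕ
∑ xs f = sum (map f xs)

∑-cong : (xs : List A) {f g : A → ℕ} → (∀ x → f x ≡ g x) → ∑ xs f ≡ ∑ xs g
∑-cong xs f≗g = cong sum (map-cong f≗g xs)

∑-mono : (xs : List A) {f g : A → ℕ} → (∀ x → f x ≤ g x) → ∑ xs f ≤ ∑ xs g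
∑-mono []       f≤g = z≤n
∑-mono (x ∷ xs) f≤g = +-mono-≤ (f≤g x) (∑-mono xs f≤g)

∑-++ : (xs ys : List A) (f : A → ℕ) → ∑ (xs ++ ys) f ≡ ∑ xs f + ∑ ys f
∑-++ xs ys f = trans (cong sum (map-++ f xs ys)) (sum-++ (map f xs) (map f ys))

∑-map : (xs : List A) (g : A → B) (f : B → ℕ) → ∑ (map g xs) f ≡ ∑ xs (f ∘ g)
∑-map xs g f = cong sum (sym (map-∘ xs))

∑-const : (xs : List A) {f : A → ℕ} {c : ℕ} → All (λ x → f x ≡ c) xs → ∑ xs f ≡ length xs * c
∑-const []       []       = refl
∑-const (x ∷ xs) (e ∷ es) = cong₂ _+_ e (∑-const xs es)

∑-zero : (xs : List A) {f : A → ℕ} → (∀ x → f x ≡ 0) → ∑ xs f ≡ 0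
∑-zero []       f≡0 = refl
∑-zero (x ∷ xs) f≡0 = cong₂ _+_ (f≡0 x) (∑-zero xs f≡0)

∑-+ : (xs : List A) (f g : A → ℕ) → ∑ xs (λ x → f x + g x) ≡ ∑ xs f + ∑ xs g
∑-+ []       f g = refl
∑-+ (x ∷ xs) f g rewrite ∑-+ xs f g = interchange (f x) (g x) (∑ xs f) (∑ xs g)
  where
  interchange : ∀ a b c d → a + b + (c + d) ≡ a + c + (b + d)
  interchange = solve-∀

∑-* : (c : ℕ) (xs : List A) (f : A → ℕ) → ∑ xs (λ x → c * f x) ≡ c * ∑ xs f
∑-* c []       f = sym (*-zeroʳ c)
∑-* c (x ∷ xs) f rewrite ∑-* c xs f = sym (*-distribˡ-+ c (f x) (∑ xs f))

∑-swap : (xs : List A) (ys : List B) (f : A → B → ℕ) →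
  ∑ xs (λ x → ∑ ys (f x)) ≡ ∑ ys (λ y → ∑ xs (λ x → f x y))
∑-swap []       ys f = sym (∑-zero ys (λ _ → refl))
∑-swap (x ∷ xs) ys f rewrite ∑-swap xs ys f = sym (∑-+ ys (f x) (λ y → ∑ xs (λ z → f z y)))

∑-take-≤ : (r : ℕ) (xs : List A) (f : A → ℕ) → ∑ (take r xs) f ≤ ∑ xs f
∑-take-≤ zero    xs       f = z≤n
∑-take-≤ (suc r) []       f = z≤n
∑-take-≤ (suc r) (x ∷ xs) f = +-monoʳ-≤ (f x) (∑-take-≤ r xs f)

∑-allFin-suc : (f : Fin (suc n) → ℕ) → ∑ (allFin (suc n)) f ≡ f zero + ∑ (allFin n) (f ∘ suc)
∑-allFin-suc f = cong (λ l → f zero + sum l)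
  (trans (map-tabulate suc f) (sym (map-tabulate id (f ∘ suc))))

∑-lookup : (xs : List A) (f : A → ℕ) → ∑ (allFin (length xs)) (f ∘ lookup xs) ≡ ∑ xs f
∑-lookup xs f = cong sum (trans (map-tabulate id (f ∘ lookup xs))
  (trans (sym (map-tabulate (lookup xs) f)) (cong (map f) (tabulate-lookup xs))))

-- Indicators

χ : Dec P → ℕ
χ d = if does d then 1 else 0

χ-yes : (d : Dec P) → P → χ d ≡ 1
χ-yes d p rewrite dec-true d p = refl

χ-no : (d : Dec P) → ¬ P → χ d ≡ 0
χ-no d ¬p rewrite dec-false d ¬p = refl

χ-×-dec : (d : Dec P) (e : Dec Q) → χ (d ×-dec e) ≡ χ d * χ e
χ-×-dec d e with does d | does e
... | true  | true  = refl
... | true  | false = refl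
... | false | _     = refl

∑-filter : {P : A → Set} (P? : Decidable P) (xs : List A) (f : A → ℕ) →
  ∑ (filter P? xs) f ≡ ∑ xs (λ x → χ (P? x) * f x)
∑-filter P? []       f = refl
∑-filter P? (x ∷ xs) f with does (P? x)
... | true  = cong₂ _+_ (sym (+-identityʳ (f x))) (∑-filter P? xs f)
... | false = ∑-filter P? xs f

∑χ≤1 : {P : Fin n → Set} (P? : Decidable P) → (∀ i j → P i → P j → i ≡ j) →
  ∑ (allFin n) (χ ∘ P?) ≤ 1
∑χ≤1 {zero}  P? unique = z≤n
∑χ≤1 {suc n} P? unique rewrite ∑-allFin-suc (χ ∘ P?) with P? zero
... | yes p = ≤-reflexive (cong suc (∑-zero (allFin n)
                (λ i → χ-no (P? (suc i)) λ q → contradiction (unique zero (suc i) p q) λ ())))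
... | no _  = ∑χ≤1 (P? ∘ suc) (λ i j p q → suc-injective (unique (suc i) (suc j) p q))

∣tabulate∣ : {P : Fin n → Set} (P? : Decidable P) →
  ∣ tabulateᵥ (does ∘ P?) ∣ ≡ ∑ (allFin n) (χ ∘ P?)
∣tabulate∣ {zero}  P? = refl
∣tabulate∣ {suc n} P? rewrite ∑-allFin-suc (χ ∘ P?) with does (P? zero)
... | true  = cong suc (∣tabulate∣ (P? ∘ suc))
... | false = ∣tabulate∣ (P? ∘ suc)

-- Binomial coefficients

-- Absorption, with (n - k) C(n,k) moved across so that k > n needs no side condition. Pascal's rule
-- reduces the step to the hypotheses at k + 1 and k.
C-absorb : ∀ n k → suc k * (n C suc k) + k * (n C k) ≡ n * (n C k)
C-absorb zero    zero    = refl
C-absorb zero    (suc k) rewrite k>n⇒nCk≡0 {0} {suc (suc k)} (s≤s z≤n) | k>n⇒nCk≡0 {0} {suc k} (s≤s z≤n)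
                               | *-zeroʳ k = refl
C-absorb (suc n) zero    rewrite nC1≡n (suc n) = arith n
  where
  arith : ∀ n → suc n + 0 + 0 ≡ suc n * 1
  arith = solve-∀
C-absorb (suc n) (suc k)
  rewrite sym (nCk+nC[k+1]≡[n+1]C[k+1] n (suc k)) | sym (nCk+nC[k+1]≡[n+1]C[k+1] n k) =
  trans (split k (n C k) (n C suc k) (n C suc (suc k)))
    (trans (cong₂ _+_ (cong₂ _+_ (C-absorb n (suc k)) (C-absorb n k)) refl)
      (merge n (n C k) (n C suc k)))
  where
  split : ∀ k a b c → suc (suc k) * (b + c) + suc k * (a + b)
    ≡ (suc (suc k) * c + suc k * b) + (suc k * b + k * a) + (a + b)
  split = solve-∀
  merge : ∀ n a b → n * b + n * a + (a + b) ≡ suc n * (a + b)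
  merge = solve-∀

C-suc-suc-mono : ∀ n k → n C k ≤ suc n C suc k
C-suc-suc-mono n k = subst (n C k ≤_) (nCk+nC[k+1]≡[n+1]C[k+1] n k) (m≤m+n _ _)

-- Equality holds at j = 0, and raising both entries of a binomial coefficient never lowers it. This
-- is the increment needed in `C-lower`: by Pascal's rule, passing from j + 1 to j + 2 there adds
-- the left side here to its left side and the right side here to its right side.
[L+1]L≤2C : ∀ L j → suc L * L ≤ 2 * ((L + suc j) C suc (suc j))
[L+1]L≤2C L zero    = +-cancelʳ-≤ (suc L) _ _ (≤-reflexive (begin
  suc L * L + suc L                     ≡⟨ arith L ⟩
  (L + 1) * (L + 1)                     ≡⟨ cong ((L + 1) *_) (sym (nC1≡n (L + 1))) ⟩
  (L + 1) * ((L + 1) C 1)               ≡⟨ sym (C-absorb (L + 1) 1) ⟩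
  2 * ((L + 1) C 2) + 1 * ((L + 1) C 1) ≡⟨ cong (λ x → 2 * ((L + 1) C 2) + 1 * x) (nC1≡n (L + 1)) ⟩
  2 * ((L + 1) C 2) + 1 * (L + 1)       ≡⟨ cong (2 * ((L + 1) C 2) +_) (trans (*-identityˡ (L + 1)) (+-comm L 1)) ⟩
  2 * ((L + 1) C 2) + suc L             ∎))
  where
  open ≡-Reasoning
  arith : ∀ L → suc L * L + suc L ≡ (L + 1) * (L + 1)
  arith = solve-∀
[L+1]L≤2C L (suc j) = ≤-trans ([L+1]L≤2C L j) (*-monoʳ-≤ 2
  (subst (λ x → (L + suc j) C suc (suc j) ≤ x C suc (suc (suc j))) (sym (+-suc L (suc j)))
    (C-suc-suc-mono (L + suc j) (suc (suc j)))))

-- Equality holds at j = 1 and j = 2, i.e. for members of size k − 2 and k − 3.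
C-lower : ∀ l j → suc (suc l) * (2 + suc l * j) ≤ 2 * ((suc l + j) C j) + suc (suc l) * suc l
C-lower l zero          = subst (suc (suc l) * (2 + suc l * 0) ≤_) (arith l) (m≤m+n _ (l + l * l))
  where
  arith : ∀ l → suc (suc l) * (2 + suc l * 0) + (l + l * l) ≡ 2 * 1 + suc (suc l) * suc l
  arith = solve-∀
C-lower l (suc zero)    rewrite nC1≡n (suc l + 1) = ≤-reflexive (arith l)
  where
  arith : ∀ l → suc (suc l) * (2 + suc l * 1) ≡ 2 * (suc l + 1) + suc (suc l) * suc l
  arith = solve-∀
C-lower l (suc (suc j)) = begin
  suc L * (2 + L * suc (suc j))                        ≡⟨ arith L j ⟩
  suc L * (2 + L * suc j) + suc L * L                  ≤⟨ +-mono-≤ (C-lower l (suc j)) ([L+1]L≤2C L j) ⟩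
  2 * c + suc L * L + 2 * c′                           ≡⟨ arith′ c c′ (suc L * L) ⟩
  2 * (c + c′) + suc L * L                             ≡⟨ cong (λ x → 2 * x + suc L * L) pascal ⟩
  2 * ((L + suc (suc j)) C suc (suc j)) + suc L * L    ∎
  where
  open ≤-Reasoning
  L = suc l
  c  = (L + suc j) C suc j
  c′ = (L + suc j) C suc (suc j)
  pascal : c + c′ ≡ (L + suc (suc j)) C suc (suc j)
  pascal = trans (nCk+nC[k+1]≡[n+1]C[k+1] (L + suc j) (suc j))
    (cong (_C suc (suc j)) (sym (+-suc L (suc j))))
  arith : ∀ L j → suc L * (2 + L * suc (suc j)) ≡ suc L * (2 + L * suc j) + suc L * L
  arith = solve-∀
  arith′ : ∀ a b c → 2 * a + c + 2 * b ≡ 2 * (a + b) + c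
  arith′ = solve-∀

-- Counting subsets

subsets : (m : ℕ) → List (Subset m)
subsets zero    = [] ∷ []
subsets (suc m) = map (inside ∷_) (subsets m) ++ map (outside ∷_) (subsets m)

∑-subsets-suc : (f : Subset (suc m) → ℕ) →
  ∑ (subsets (suc m)) f ≡ ∑ (subsets m) (f ∘ (inside ∷_)) + ∑ (subsets m) (f ∘ (outside ∷_))
∑-subsets-suc {m} f = trans (∑-++ (map (inside ∷_) (subsets m)) _ f)
  (cong₂ _+_ (∑-map (subsets m) (inside ∷_) f) (∑-map (subsets m) (outside ∷_) f))

-- The last two factors are grouped as the summand of `∑-below`, so that `packing` can pull them out
-- of a sum over p.
inInterval : Subset m → Subset m → ℕ → Subset m → ℕ
inInterval p q s r = χ (p ⊆? r) * (χ (r ⊆? q) * χ (∣ r ∣ ≟ s))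

-- Only coordinates in q but not in p leave a choice, and there the two choices give the two terms
-- of Pascal's rule.
∑-interval : (p q : Subset m) (j : ℕ) → p ⊆ q →
  ∑ (subsets m) (inInterval p q (∣ p ∣ + j)) ≡ (∣ q ∣ ∸ ∣ p ∣) C j
∑-interval []            []            zero    p⊆q = refl
∑-interval []            []            (suc j) p⊆q = sym (k>n⇒nCk≡0 {0} {suc j} (s≤s z≤n))
∑-interval {suc m} (outside ∷ p) (outside ∷ q) j p⊆q
  rewrite ∑-subsets-suc (inInterval (outside ∷ p) (outside ∷ q) (∣ p ∣ + j))
        | ∑-zero (subsets m) (λ r → *-zeroʳ (χ (p ⊆? r))) =
  ∑-interval p q j (drop-∷-⊆ p⊆q)
∑-interval {suc m} (inside  ∷ p) (inside  ∷ q) j p⊆q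
  rewrite ∑-subsets-suc (inInterval (inside ∷ p) (inside ∷ q) (suc (∣ p ∣ + j)))
        | ∑-zero (subsets m) (λ r → refl {x = 0}) =
  trans (+-identityʳ _) (∑-interval p q j (drop-∷-⊆ p⊆q))
∑-interval {suc m} (inside  ∷ p) (outside ∷ q) j p⊆q with () ← p⊆q here
∑-interval {suc m} (outside ∷ p) (inside  ∷ q) zero p⊆q
  rewrite ∑-subsets-suc (inInterval (outside ∷ p) (inside ∷ q) (∣ p ∣ + 0)) =
  cong₂ _+_ (∑-zero (subsets m) empty) (∑-interval p q zero (drop-∷-⊆ p⊆q))
  where
  -- With j = 0, taking the new element would leave fewer than ∣p∣ elements for a superset of p.
  empty : ∀ r → χ (p ⊆? r) * (χ (r ⊆? q) * χ (suc ∣ r ∣ ≟ ∣ p ∣ + 0)) ≡ 0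
  empty r with p ⊆? r
  ... | no _    = refl
  ... | yes p⊆r rewrite χ-no (suc ∣ r ∣ ≟ ∣ p ∣ + 0)
                    (λ e → <⇒≱ (≤-reflexive (trans e (+-identityʳ ∣ p ∣))) (p⊆q⇒∣p∣≤∣q∣ p⊆r))
                      | *-zeroʳ (χ (r ⊆? q)) = refl
∑-interval {suc m} (outside ∷ p) (inside  ∷ q) (suc j) p⊆q
  rewrite ∑-subsets-suc (inInterval (outside ∷ p) (inside ∷ q) (∣ p ∣ + suc j)) =
  trans (cong₂ _+_
          (trans (∑-cong (subsets m) λ r → cong (λ s → χ (p ⊆? r) * (χ (r ⊆? q) * χ (suc ∣ r ∣ ≟ s))) (+-suc ∣ p ∣ j))
            (∑-interval p q j p⊆q′))
          (∑-interval p q (suc j) p⊆q′))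
    (trans (nCk+nC[k+1]≡[n+1]C[k+1] (∣ q ∣ ∸ ∣ p ∣) j)
      (cong (_C suc j) (sym (+-∸-assoc 1 (p⊆q⇒∣p∣≤∣q∣ p⊆q′)))))
  where p⊆q′ = drop-∷-⊆ p⊆q

∑-interval-χ : (p q : Subset m) (j : ℕ) →
  ∑ (subsets m) (inInterval p q (∣ p ∣ + j)) ≡ χ (p ⊆? q) * ((∣ q ∣ ∸ ∣ p ∣) C j)
∑-interval-χ {m} p q j with p ⊆? q
... | yes p⊆q = trans (∑-interval p q j p⊆q) (sym (+-identityʳ _))
... | no  p⊈q = ∑-zero (subsets m) empty
  where
  empty : ∀ r → inInterval p q (∣ p ∣ + j) r ≡ 0
  empty r with p ⊆? r
  ... | no _    = refl
  ... | yes p⊆r rewrite χ-no (r ⊆? q) (λ r⊆q → p⊈q (⊆-trans p⊆r r⊆q)) = refl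

∑-below : (q : Subset m) (s : ℕ) →
  ∑ (subsets m) (λ r → χ (r ⊆? q) * χ (∣ r ∣ ≟ s)) ≡ ∣ q ∣ C s
∑-below {m} q s = begin
  ∑ (subsets m) (λ r → χ (r ⊆? q) * χ (∣ r ∣ ≟ s)) ≡⟨ ∑-cong (subsets m) pointwise ⟩
  ∑ (subsets m) (inInterval ⊥ q (∣ ⊥ {m} ∣ + s))   ≡⟨ ∑-interval ⊥ q s (⊆-min q) ⟩
  (∣ q ∣ ∸ ∣ ⊥ {m} ∣) C s                          ≡⟨ cong (λ z → (∣ q ∣ ∸ z) C s) (∣⊥∣≡0 m) ⟩
  ∣ q ∣ C s                                        ∎
  where
  open ≡-Reasoning
  pointwise : ∀ r → χ (r ⊆? q) * χ (∣ r ∣ ≟ s) ≡ inInterval ⊥ q (∣ ⊥ {m} ∣ + s) r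
  pointwise r rewrite χ-yes (⊥ ⊆? r) (⊆-min r) | ∣⊥∣≡0 m = sym (+-identityʳ _)

∑-above : (p : Subset m) (j : ℕ) →
  ∑ (subsets m) (λ r → χ (p ⊆? r) * χ (∣ r ∣ ≟ ∣ p ∣ + j)) ≡ (m ∸ ∣ p ∣) C j
∑-above {m} p j = begin
  ∑ (subsets m) (λ r → χ (p ⊆? r) * χ (∣ r ∣ ≟ ∣ p ∣ + j)) ≡⟨ ∑-cong (subsets m) pointwise ⟩
  ∑ (subsets m) (inInterval p ⊤ (∣ p ∣ + j))   ≡⟨ ∑-interval p ⊤ j (⊆-max p) ⟩
  (∣ ⊤ {m} ∣ ∸ ∣ p ∣) C j                      ≡⟨ cong (λ z → (z ∸ ∣ p ∣) C j) (∣⊤∣≡n m) ⟩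
  (m ∸ ∣ p ∣) C j                              ∎
  where
  open ≡-Reasoning
  pointwise : ∀ r → χ (p ⊆? r) * χ (∣ r ∣ ≟ ∣ p ∣ + j) ≡ inInterval p ⊤ (∣ p ∣ + j) r
  pointwise r rewrite χ-yes (r ⊆? ⊤) (⊆-max r) = cong (χ (p ⊆? r) *_) (sym (+-identityʳ _))

-- The dual form of the batch code condition

-- Too many members inside S may mean more than k of them; this cuts their index set down to ∣S∣ +
-- 1, where the batch code condition applies.
shrink : (J : Subset n) (r : ℕ) → r ≤ ∣ J ∣ → ∃ λ I → I ⊆ J × ∣ I ∣ ≡ r
shrink {n} J             zero    r≤J = ⊥ , ⊆-min J , ∣⊥∣≡0 n
shrink     (outside ∷ J) (suc r) r≤J with I , I⊆J , e ← shrink J (suc r) r≤J =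
  outside ∷ I , s⊆s I⊆J , e
shrink     (inside  ∷ J) (suc r) r≤J with I , I⊆J , e ← shrink J r (s≤s⁻¹ r≤J) =
  inside ∷ I , s⊆s I⊆J , cong suc e

∈-tabulate⁺ : {P : Fin n → Set} (P? : Decidable P) {i : Fin n} → P i → i ∈ tabulateᵥ (does ∘ P?)
∈-tabulate⁺ P? {i} p = lookup⇒[]= i _ (trans (lookup∘tabulate (does ∘ P?) i) (dec-true (P? i) p))

∈-tabulate⁻ : {P : Fin n → Set} (P? : Decidable P) {i : Fin n} → i ∈ tabulateᵥ (does ∘ P?) → P i
∈-tabulate⁻ P? {i} i∈ with P? i | trans (sym (lookup∘tabulate (does ∘ P?) i)) ([]=⇒lookup i∈)
... | yes p | _  = p
... | no _  | ()

p⊆⋃ : {p : Subset m} {ps : List (Subset m)} → p ∈ₗ ps → p ⊆ ⋃ ps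
p⊆⋃ {ps = p ∷ ps} (here refl) = p⊆p∪q (⋃ ps)
p⊆⋃ {ps = q ∷ ps} (there p∈)  = ⊆-trans (p⊆⋃ p∈) (q⊆p∪q q (⋃ ps))

⋃⊆ : {S : Subset m} (ps : List (Subset m)) → (∀ {p} → p ∈ₗ ps → p ⊆ S) → ⋃ ps ⊆ S
⋃⊆ []       ps⊆S x∈ = contradiction x∈ ∉⊥
⋃⊆ (p ∷ ps) ps⊆S x∈ = [ ps⊆S (here refl) , ⋃⊆ ps (ps⊆S ∘ there) ]′ (x∈p∪q⁻ p (⋃ ps) x∈)

⊆unionOver : (I : Subset n) (X : Fin n → Subset m) {j : Fin n} → j ∈ I → X j ⊆ unionOver I X
⊆unionOver I X {j} j∈I = p⊆⋃ (∈-map⁺ X (∈-filter⁺ (_∈? I) (∈-allFin j) j∈I))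

unionOver⊆ : (I : Subset n) (X : Fin n → Subset m) {S : Subset m} →
  (∀ {j} → j ∈ I → X j ⊆ S) → unionOver I X ⊆ S
unionOver⊆ {n} I X X⊆S = ⋃⊆ _ member
  where
  member : ∀ {p} → p ∈ₗ map X (filter (_∈? I) (allFin n)) → p ⊆ _
  member p∈ with j , j∈ , refl ← ∈-map⁻ X p∈ = X⊆S (proj₂ (∈-filter⁻ (_∈? I) {xs = allFin n} j∈))

-- The sum runs over indices, so a repeated set counts with its multiplicity.
Sparse : (n k m : ℕ) → (Fin n → Subset m) → Set
Sparse n k m X = ∀ S → ∣ S ∣ < k → ∑ (allFin n) (λ j → χ (X j ⊆? S)) ≤ ∣ S ∣

-- If more than ∣S∣ members lie in S, then ∣S∣ + 1 ≤ k of them have a union inside S, which is too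
-- small.
CBC⇒Sparse : (X : Fin n → Subset m) → IsCBC n k m X → Sparse n k m X
CBC⇒Sparse {n} X cbc S S<k with ∑ (allFin n) (λ j → χ (X j ⊆? S)) ≤? ∣ S ∣
... | yes le = le
... | no ¬le
  with I , I⊆J , ∣I∣≡ ← shrink (tabulateᵥ (λ j → does (X j ⊆? S))) (suc ∣ S ∣)
         (subst (suc ∣ S ∣ ≤_) (sym (∣tabulate∣ (λ j → X j ⊆? S))) (≰⇒> ¬le)) =
  contradiction
    (≤-trans (subst (_≤ ∣ unionOver I X ∣) ∣I∣≡
               (cbc I (subst (1 ≤_) (sym ∣I∣≡) (s≤s z≤n)) (subst (_≤ _) (sym ∣I∣≡) S<k)))
             (p⊆q⇒∣p∣≤∣q∣ (unionOver⊆ I X (λ j∈I → ∈-tabulate⁻ (λ j → X j ⊆? S) (I⊆J j∈I)))))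
    (<-irrefl refl)

-- Take for S the union U over I. If ∣U∣ < ∣I∣ ≤ k, sparsity applies to U, yet U contains every
-- member indexed by I.
Sparse⇒CBC : (X : Fin n → Subset m) → Sparse n k m X → IsCBC n k m X
Sparse⇒CBC X sparse I 1≤I I≤k with ∣ I ∣ ≤? ∣ unionOver I X ∣
... | yes le = le
... | no ¬le = ≤-trans (p⊆q⇒∣p∣≤∣q∣ (∈-tabulate⁺ X⊆U? ∘ ⊆unionOver I X))
    (subst (_≤ ∣ U ∣) (sym (∣tabulate∣ X⊆U?)) (sparse U (<-≤-trans (≰⇒> ¬le) I≤k)))
  where
  U = unionOver I X
  X⊆U? = λ j → X j ⊆? U

Sparse⇒CBCExists : (Fs : List (Subset m)) →
  (∀ S → ∣ S ∣ < k → ∑ Fs (λ F → χ (F ⊆? S)) ≤ ∣ S ∣) →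
  CBCExists (length Fs) (∑ Fs ∣_∣) k m
Sparse⇒CBCExists Fs sparse = lookup Fs
  , Sparse⇒CBC (lookup Fs) (λ S S<k → subst (_≤ ∣ S ∣) (sym (∑-lookup Fs (λ F → χ (F ⊆? S)))) (sparse S S<k))
  , ∑-lookup Fs ∣_∣

-- The lower bound

-- The contribution of one member p to the count, where s = k - 2. The term in ∣p∣ stands on the
-- right because s - ∣p∣ may be negative.
weight-bound : ∀ l s → m ≡ suc l + suc s → (p : Subset m) →
  suc (suc l) * (2 + suc l * s) ≤
    2 * ∑ (subsets m) (λ r → χ (p ⊆? r) * χ (∣ r ∣ ≟ suc s)) + suc (suc l) * (suc l * ∣ p ∣)
weight-bound {m} l s refl p with ∣ p ∣ ≤? suc s
-- The added `suc L * L` turns s into s + 1 = ∣p∣ + j and matches the constant in `C-lower`.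
... | yes p≤s = +-cancelʳ-≤ (suc L * L) _ _ (begin
  suc L * (2 + L * s) + suc L * L               ≡⟨ arith L s ⟩
  suc L * (2 + L * suc s)                       ≡⟨ cong (λ x → suc L * (2 + L * x)) s≡ ⟩
  suc L * (2 + L * (∣ p ∣ + j))                 ≡⟨ arith₁ L ∣ p ∣ j ⟩
  suc L * (2 + L * j) + suc L * (L * ∣ p ∣)     ≤⟨ +-monoˡ-≤ _ (C-lower l j) ⟩
  2 * ((L + j) C j) + suc L * L + suc L * (L * ∣ p ∣)  ≡⟨ arith₂ (2 * ((L + j) C j)) (suc L * L) _ ⟩
  2 * ((L + j) C j) + suc L * (L * ∣ p ∣) + suc L * L  ≡⟨ cong (λ x → 2 * x + suc L * (L * ∣ p ∣) + suc L * L) (sym above) ⟩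
  2 * ∑ (subsets m) (λ r → χ (p ⊆? r) * χ (∣ r ∣ ≟ suc s)) + suc L * (L * ∣ p ∣) + suc L * L ∎)
  where
  open ≤-Reasoning
  L = suc l
  j = suc s ∸ ∣ p ∣
  s≡ : suc s ≡ ∣ p ∣ + j
  s≡ = sym (m+[n∸m]≡n p≤s)
  above : ∑ (subsets m) (λ r → χ (p ⊆? r) * χ (∣ r ∣ ≟ suc s)) ≡ (L + j) C j
  above = trans (cong (λ x → ∑ (subsets m) (λ r → χ (p ⊆? r) * χ (∣ r ∣ ≟ x))) s≡)
    (trans (∑-above p j) (cong (_C j) (+-∸-assoc L p≤s)))
  arith : ∀ L s → suc L * (2 + L * s) + suc L * L ≡ suc L * (2 + L * suc s)
  arith = solve-∀
  arith₁ : ∀ L i j → suc L * (2 + L * (i + j)) ≡ suc L * (2 + L * j) + suc L * (L * i)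
  arith₁ = solve-∀
  arith₂ : ∀ a b c → a + b + c ≡ a + c + b
  arith₂ = solve-∀
-- A set of size at least k lies in no (k - 1)-set, but its size alone suffices: L ∣p∣ ≥ L (s + 2) ≥
-- 2 + L s since L ≥ 1.
... | no p≰s = ≤-trans (*-monoʳ-≤ (suc L) (begin
  2 + L * s         ≤⟨ +-monoˡ-≤ (L * s) (*-monoʳ-≤ 2 (s≤s (z≤n {l}))) ⟩
  2 * L + L * s     ≡⟨ arith L s ⟩
  L * suc (suc s)   ≤⟨ *-monoʳ-≤ L (≰⇒> p≰s) ⟩
  L * ∣ p ∣         ∎)) (m≤n+m _ (2 * ∑ (subsets m) (λ r → χ (p ⊆? r) * χ (∣ r ∣ ≟ suc s))))
  where
  open ≤-Reasoning
  L = suc l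
  arith : ∀ L s → 2 * L + L * s ≡ L * suc (suc s)
  arith = solve-∀

-- Here k = 2 + s and l = m − k.
CBC-lower : ∀ l s → m ≡ suc l + suc s → (X : Fin n → Subset m) → IsCBC n (suc (suc s)) m X →
  n * (2 + suc l * s) ≤ 2 * (m C s) + suc l * totalSize X
CBC-lower {m} {n} l s m≡ X cbc = *-cancelˡ-≤ (suc L) (begin
  suc L * (n * (2 + L * s))                             ≡⟨ swap (suc L) n (2 + L * s) ⟩
  n * (suc L * (2 + L * s))                             ≡⟨ sym (trans (∑-const (allFin n) {f = λ _ → suc L * (2 + L * s)} (tabulate⁺ (λ _ → refl)))
                                                            (cong (_* (suc L * (2 + L * s))) (length-tabulate {n = n} id))) ⟩
  ∑ (allFin n) (λ _ → suc L * (2 + L * s))              ≤⟨ ∑-mono (allFin n) (weight-bound l s m≡ ∘ X) ⟩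
  ∑ (allFin n) (λ j → 2 * above j + suc L * (L * ∣ X j ∣)) ≡⟨ ∑-+ (allFin n) (λ j → 2 * above j) (λ j → suc L * (L * ∣ X j ∣)) ⟩
  ∑ (allFin n) (λ j → 2 * above j) + ∑ (allFin n) (λ j → suc L * (L * ∣ X j ∣))
    ≡⟨ cong₂ _+_ (∑-* 2 (allFin n) above)
         (trans (∑-* (suc L) (allFin n) _) (cong (suc L *_) (∑-* L (allFin n) _))) ⟩
  2 * ∑ (allFin n) above + suc L * (L * totalSize X)    ≤⟨ +-monoˡ-≤ _ (*-monoʳ-≤ 2 pairs) ⟩
  2 * (suc L * (m C s)) + suc L * (L * totalSize X)     ≡⟨ arith (suc L) (m C s) (L * totalSize X) ⟩
  suc L * (2 * (m C s) + L * totalSize X)               ∎)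
  where
  open ≤-Reasoning
  L = suc l
  above : Fin n → ℕ
  above j = ∑ (subsets m) (λ r → χ (X j ⊆? r) * χ (∣ r ∣ ≟ suc s))
  swap : ∀ a b c → a * (b * c) ≡ b * (a * c)
  swap = solve-∀
  arith : ∀ a b c → 2 * (a * b) + a * c ≡ a * (2 * b + c)
  arith = solve-∀
  -- Sparsity of the batch code enters here. The factor for r ⊆ ⊤ equals 1 and gives the sum the
  -- shape of `∑-below`.
  below : ∀ r → ∑ (allFin n) (λ j → χ (X j ⊆? r) * χ (∣ r ∣ ≟ suc s)) ≤
    suc s * (χ (r ⊆? ⊤) * χ (∣ r ∣ ≟ suc s))
  below r rewrite χ-yes (r ⊆? ⊤) (⊆-max r) with ∣ r ∣ ≟ suc s
  ... | no ne rewrite χ-no (∣ r ∣ ≟ suc s) ne =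
    ≤-trans (≤-reflexive (∑-zero (allFin n) (λ j → *-zeroʳ (χ (X j ⊆? r))))) z≤n
  ... | yes e rewrite χ-yes (∣ r ∣ ≟ suc s) e = begin
    ∑ (allFin n) (λ j → χ (X j ⊆? r) * 1) ≡⟨ ∑-cong (allFin n) (λ j → *-identityʳ _) ⟩
    ∑ (allFin n) (λ j → χ (X j ⊆? r))     ≤⟨ CBC⇒Sparse X cbc r (s≤s (≤-reflexive e)) ⟩
    ∣ r ∣                                 ≡⟨ e ⟩
    suc s                                 ≡⟨ sym (*-identityʳ (suc s)) ⟩
    suc s * 1                             ∎
  -- Since m - s = L + 1, the bound on the pairs acquires the factor L + 1 that is cancelled at the
  -- end.
  absorb : suc s * (m C suc s) ≡ suc L * (m C s)
  absorb = +-cancelʳ-≡ (s * (m C s)) _ _ (trans (C-absorb m s)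
    (trans (cong (_* (m C s)) (trans m≡ (+-suc L s))) (*-distribʳ-+ (m C s) (suc L) s)))
  pairs : ∑ (allFin n) above ≤ suc L * (m C s)
  pairs = begin
    ∑ (allFin n) above        ≡⟨ ∑-swap (allFin n) (subsets m) _ ⟩
    ∑ (subsets m) (λ r → ∑ (allFin n) (λ j → χ (X j ⊆? r) * χ (∣ r ∣ ≟ suc s))) ≤⟨ ∑-mono (subsets m) below ⟩
    ∑ (subsets m) (λ r → suc s * (χ (r ⊆? ⊤) * χ (∣ r ∣ ≟ suc s)))  ≡⟨ ∑-* (suc s) (subsets m) _ ⟩
    suc s * ∑ (subsets m) (λ r → χ (r ⊆? ⊤) * χ (∣ r ∣ ≟ suc s))    ≡⟨ cong (suc s *_) (∑-below (⊤ {m}) (suc s)) ⟩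
    suc s * (∣ ⊤ {m} ∣ C suc s)                                      ≡⟨ cong (λ x → suc s * (x C suc s)) (∣⊤∣≡n m) ⟩
    suc s * (m C suc s)                                              ≡⟨ absorb ⟩
    suc L * (m C s)                                                  ∎

-- Constant weight codes

-- The left side is twice the size of the union: an element of exactly one set counts 1 + 1, an
-- element of both counts 0 + 2.
dist-⊆ : (p q r : Subset m) → p ⊆ r → q ⊆ r → dist p q + (∣ p ∣ + ∣ q ∣) ≤ 2 * ∣ r ∣
dist-⊆ []            []            []            p⊆r q⊆r = z≤n
dist-⊆ (inside ∷ p)  (_ ∷ q)       (outside ∷ r) p⊆r q⊆r with () ← p⊆r here
dist-⊆ (outside ∷ p) (inside ∷ q)  (outside ∷ r) p⊆r q⊆r with () ← q⊆r here
dist-⊆ (outside ∷ p) (outside ∷ q) (outside ∷ r) p⊆r q⊆r =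
  dist-⊆ p q r (drop-∷-⊆ p⊆r) (drop-∷-⊆ q⊆r)
dist-⊆ (outside ∷ p) (outside ∷ q) (inside ∷ r)  p⊆r q⊆r =
  ≤-trans (dist-⊆ p q r (drop-∷-⊆ p⊆r) (drop-∷-⊆ q⊆r)) (*-monoʳ-≤ 2 (n≤1+n ∣ r ∣))
dist-⊆ (inside ∷ p)  (outside ∷ q) (inside ∷ r)  p⊆r q⊆r =
  subst₂ _≤_ (arith (dist p q) ∣ p ∣ ∣ q ∣) (sym (*-suc 2 ∣ r ∣))
    (+-monoʳ-≤ 2 (dist-⊆ p q r (drop-∷-⊆ p⊆r) (drop-∷-⊆ q⊆r)))
  where
  arith : ∀ a b c → 2 + (a + (b + c)) ≡ suc a + (suc b + c)
  arith = solve-∀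
dist-⊆ (outside ∷ p) (inside ∷ q)  (inside ∷ r)  p⊆r q⊆r =
  subst₂ _≤_ (arith (dist p q) ∣ p ∣ ∣ q ∣) (sym (*-suc 2 ∣ r ∣))
    (+-monoʳ-≤ 2 (dist-⊆ p q r (drop-∷-⊆ p⊆r) (drop-∷-⊆ q⊆r)))
  where
  arith : ∀ a b c → 2 + (a + (b + c)) ≡ suc a + (b + suc c)
  arith = solve-∀
dist-⊆ (inside ∷ p)  (inside ∷ q)  (inside ∷ r)  p⊆r q⊆r =
  subst₂ _≤_ (arith (dist p q) ∣ p ∣ ∣ q ∣) (sym (*-suc 2 ∣ r ∣))
    (+-monoʳ-≤ 2 (dist-⊆ p q r (drop-∷-⊆ p⊆r) (drop-∷-⊆ q⊆r)))
  where
  arith : ∀ a b c → 2 + (a + (b + c)) ≡ a + (suc b + suc c)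
  arith = solve-∀

IsCWCode-shorten : ∀ {d w t a} (D : Fin a → Subset m) (t≤a : t ≤ a) →
  IsCWCode m d w a D → IsCWCode m d w t (λ i → D (inject≤ i t≤a))
IsCWCode-shorten D t≤a (weight , distance) =
  (λ i → weight (inject≤ i t≤a)) ,
  (λ i j i≢j → distance (inject≤ i t≤a) (inject≤ j t≤a) (i≢j ∘ inject≤-injective t≤a t≤a i j))

-- Packing (w + 1)-sets around the codewords

module _ {m w t : ℕ} (D : Fin t → Subset m) (code : IsCWCode m 4 w t D) where

  codewordsIn : Subset m → ℕ
  codewordsIn S = ∑ (allFin t) (λ i → χ (D i ⊆? S))

  -- Two distinct codewords in S would give 4 + 2w ≤ 2 ∣S∣ ≤ 2w + 2.
  codewordsIn≤1 : ∀ S → ∣ S ∣ ≤ suc w → codewordsIn S ≤ 1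
  codewordsIn≤1 S S≤ = ∑χ≤1 (λ i → D i ⊆? S) unique
    where
    arith : ∀ w → 4 + (w + w) ≡ 2 + 2 * suc w
    arith = solve-∀
    unique : ∀ i j → D i ⊆ S → D j ⊆ S → i ≡ j
    unique i j Di⊆S Dj⊆S with i ≟ᶠ j
    ... | yes i≡j = i≡j
    ... | no  i≢j = contradiction (begin
      2 + 2 * suc w                              ≡⟨ sym (arith w) ⟩
      4 + (w + w)                                ≤⟨ +-monoˡ-≤ (w + w) (proj₂ code i j i≢j) ⟩
      dist (D i) (D j) + (w + w)                 ≡⟨ cong₂ (λ x y → dist (D i) (D j) + (x + y)) (sym (proj₁ code i)) (sym (proj₁ code j)) ⟩
      dist (D i) (D j) + (∣ D i ∣ + ∣ D j ∣)     ≤⟨ dist-⊆ (D i) (D j) S Di⊆S Dj⊆S ⟩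
      2 * ∣ S ∣                                  ≤⟨ *-monoʳ-≤ 2 S≤ ⟩
      2 * suc w                                  ∎) (m+1+n≰m (2 * suc w) ∘ subst (_≤ 2 * suc w) (+-comm 2 (2 * suc w)))
      where open ≤-Reasoning

  codewordsIn≡0 : ∀ S → ∣ S ∣ < w → codewordsIn S ≡ 0
  codewordsIn≡0 S S<w = ∑-zero (allFin t) (λ i → χ-no (D i ⊆? S)
    (λ Di⊆S → <⇒≱ S<w (subst (_≤ ∣ S ∣) (proj₁ code i) (p⊆q⇒∣p∣≤∣q∣ Di⊆S))))

  -- With w = k - 3, these are the (k - 2)-sets that survive the removal of all supersets of
  -- codewords.
  Free : Subset m → Set
  Free T = ∣ T ∣ ≡ suc w × codewordsIn T ≡ 0

  free? : Decidable Free
  free? T = ∣ T ∣ ≟ suc w ×-dec codewordsIn T ≟ 0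

  freeSets : List (Subset m)
  freeSets = filter free? (subsets m)

  freeIn : Subset m → ℕ
  freeIn S = ∑ freeSets (λ T → χ (T ⊆? S))

  codeword-or-free : ∀ T → ∣ T ∣ ≡ suc w → codewordsIn T + χ (codewordsIn T ≟ 0) ≡ 1
  codeword-or-free T T≡ with codewordsIn T | codewordsIn≤1 T (≤-reflexive T≡)
  ... | zero        | _       = refl
  ... | suc zero    | _       = refl
  ... | suc (suc _) | s≤s ()

  -- Each (w+1)-subset of S either contains exactly one codeword or is free.
  packing : ∀ S → codewordsIn S * (∣ S ∣ ∸ w) + freeIn S ≡ ∣ S ∣ C suc w
  packing S = begin
    codewordsIn S * (∣ S ∣ ∸ w) + freeIn S
      ≡⟨ cong₂ _+_ covered (trans (∑-filter free? (subsets m) _) (∑-cong (subsets m) free-term)) ⟩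
    ∑ (subsets m) (λ T → κ T * codewordsIn T) + ∑ (subsets m) (λ T → κ T * χ (codewordsIn T ≟ 0))
      ≡⟨ sym (∑-+ (subsets m) _ _) ⟩
    ∑ (subsets m) (λ T → κ T * codewordsIn T + κ T * χ (codewordsIn T ≟ 0))
      ≡⟨ ∑-cong (subsets m) exactly-one ⟩
    ∑ (subsets m) κ
      ≡⟨ ∑-below S (suc w) ⟩
    ∣ S ∣ C suc w ∎
    where
    open ≡-Reasoning
    κ : Subset m → ℕ
    κ T = χ (T ⊆? S) * χ (∣ T ∣ ≟ suc w)
    free-term : ∀ T → χ (free? T) * χ (T ⊆? S) ≡ κ T * χ (codewordsIn T ≟ 0)
    free-term T = trans (cong (_* χ (T ⊆? S)) (χ-×-dec (∣ T ∣ ≟ suc w) (codewordsIn T ≟ 0)))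
      (arith (χ (∣ T ∣ ≟ suc w)) (χ (codewordsIn T ≟ 0)) (χ (T ⊆? S)))
      where
      arith : ∀ a b c → a * b * c ≡ c * a * b
      arith = solve-∀
    exactly-one : ∀ T → κ T * codewordsIn T + κ T * χ (codewordsIn T ≟ 0) ≡ κ T
    exactly-one T with ∣ T ∣ ≟ suc w
    ... | yes e = trans (sym (*-distribˡ-+ (κ T) (codewordsIn T) _))
                    (trans (cong (κ T *_) (codeword-or-free T e)) (*-identityʳ (κ T)))
    ... | no ne rewrite χ-no (∣ T ∣ ≟ suc w) ne | *-zeroʳ (χ (T ⊆? S)) = refl
    -- A codeword inside S extends to a (w + 1)-subset of S by any one of the remaining elements.
    through : ∀ i → χ (D i ⊆? S) * (∣ S ∣ ∸ w) ≡ ∑ (subsets m) (inInterval (D i) S (suc w))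
    through i = sym (begin
      ∑ (subsets m) (inInterval (D i) S (suc w))       ≡⟨ cong (λ x → ∑ (subsets m) (inInterval (D i) S x))
                                                            (trans (+-comm 1 w) (cong (_+ 1) (sym (proj₁ code i)))) ⟩
      ∑ (subsets m) (inInterval (D i) S (∣ D i ∣ + 1)) ≡⟨ ∑-interval-χ (D i) S 1 ⟩
      χ (D i ⊆? S) * ((∣ S ∣ ∸ ∣ D i ∣) C 1)           ≡⟨ cong (χ (D i ⊆? S) *_) (nC1≡n (∣ S ∣ ∸ ∣ D i ∣)) ⟩
      χ (D i ⊆? S) * (∣ S ∣ ∸ ∣ D i ∣)                 ≡⟨ cong (λ x → χ (D i ⊆? S) * (∣ S ∣ ∸ x)) (proj₁ code i) ⟩
      χ (D i ⊆? S) * (∣ S ∣ ∸ w)                       ∎)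
    -- Double count of the pairs of a codeword and a (w + 1)-set T between it and S.
    covered : codewordsIn S * (∣ S ∣ ∸ w) ≡ ∑ (subsets m) (λ T → κ T * codewordsIn T)
    covered = begin
      codewordsIn S * (∣ S ∣ ∸ w)
        ≡⟨ *-comm (codewordsIn S) (∣ S ∣ ∸ w) ⟩
      (∣ S ∣ ∸ w) * codewordsIn S
        ≡⟨ sym (∑-* (∣ S ∣ ∸ w) (allFin t) _) ⟩
      ∑ (allFin t) (λ i → (∣ S ∣ ∸ w) * χ (D i ⊆? S))
        ≡⟨ ∑-cong (allFin t) (λ i → trans (*-comm (∣ S ∣ ∸ w) _) (through i)) ⟩
      ∑ (allFin t) (λ i → ∑ (subsets m) (inInterval (D i) S (suc w)))
        ≡⟨ ∑-swap (allFin t) (subsets m) _ ⟩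
      ∑ (subsets m) (λ T → ∑ (allFin t) (λ i → inInterval (D i) S (suc w) T))
        ≡⟨ ∑-cong (subsets m) (λ T → trans (∑-cong (allFin t) (λ i → *-comm (χ (D i ⊆? T)) (κ T))) (∑-* (κ T) (allFin t) _)) ⟩
      ∑ (subsets m) (λ T → κ T * codewordsIn T) ∎

  -- The case S = ⊤ of `packing`. It gives both the supply of free sets and the packing bound on the
  -- number of codewords.
  packing-total : t * (m ∸ w) + length freeSets ≡ m C suc w
  packing-total = begin
    t * (m ∸ w) + length freeSets
      ≡⟨ cong₂ _+_ (cong₂ _*_ (sym all-codewords) (cong (_∸ w) (sym (∣⊤∣≡n m)))) (sym all-free) ⟩
    codewordsIn ⊤ * (∣ ⊤ {m} ∣ ∸ w) + freeIn ⊤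
      ≡⟨ packing ⊤ ⟩
    ∣ ⊤ {m} ∣ C suc w
      ≡⟨ cong (_C suc w) (∣⊤∣≡n m) ⟩
    m C suc w ∎
    where
    open ≡-Reasoning
    all-codewords : codewordsIn ⊤ ≡ t
    all-codewords = trans (∑-const (allFin t) (tabulate⁺ (λ i → χ-yes (D i ⊆? ⊤) (⊆-max (D i)))))
      (trans (*-identityʳ _) (length-tabulate {n = t} id))
    all-free : freeIn ⊤ ≡ length freeSets
    all-free = trans (∑-const freeSets (universal (λ T → χ-yes (T ⊆? ⊤) (⊆-max T)) freeSets)) (*-identityʳ _)

  -- The batch code of doubled codewords and free sets

  family : ℕ → List (Subset m)
  family r = map D (allFin t) ++ map D (allFin t) ++ take r freeSets

  ∑-family : ∀ r (f : Subset m → ℕ) →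
    ∑ (family r) f ≡ ∑ (allFin t) (f ∘ D) + (∑ (allFin t) (f ∘ D) + ∑ (take r freeSets) f)
  ∑-family r f = trans (∑-++ (map D (allFin t)) _ f) (cong₂ _+_ (∑-map (allFin t) D f)
    (trans (∑-++ (map D (allFin t)) _ f) (cong (_+ ∑ (take r freeSets) f) (∑-map (allFin t) D f))))

  -- Truncating the free sets only lowers the count, so 2c + f must be bounded, for c codewords and
  -- f free sets in S. Below size w both vanish. At size w, c ≤ 1 and f = 0, so 2 ≤ w suffices. At
  -- size w + 1, c + f = 1. At size w + 2, `packing` says 2c + f = w + 2.
  family-sparse : 2 ≤ w → ∀ r S → ∣ S ∣ < 3 + w → ∑ (family r) (λ F → χ (F ⊆? S)) ≤ ∣ S ∣
  family-sparse 2≤w r S S<k = begin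
    ∑ (family r) (λ F → χ (F ⊆? S)) ≡⟨ ∑-family r _ ⟩
    c + (c + ∑ (take r freeSets) (λ F → χ (F ⊆? S))) ≤⟨ +-monoʳ-≤ c (+-monoʳ-≤ c (∑-take-≤ r freeSets _)) ⟩
    c + (c + freeIn S) ≤⟨ bound ⟩
    ∣ S ∣ ∎
    where
    open ≤-Reasoning
    c = codewordsIn S
    free-small : ∀ {s} → ∣ S ∣ ≡ s → s < suc w → freeIn S ≡ 0
    free-small {s} e s<sw = m+n≡0⇒n≡0 (c * (∣ S ∣ ∸ w)) (trans (packing S)
      (k>n⇒nCk≡0 {∣ S ∣} {suc w} (subst (_< suc w) (sym e) s<sw)))
    bound : c + (c + freeIn S) ≤ ∣ S ∣
    bound with <-cmp ∣ S ∣ w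
    ... | tri< S<w _ _ rewrite codewordsIn≡0 S S<w | free-small refl (m<n⇒m<1+n S<w) = z≤n
    ... | tri≈ _ S≡w _ rewrite free-small S≡w ≤-refl = begin
      c + (c + 0) ≤⟨ *-monoʳ-≤ 2 (codewordsIn≤1 S (≤-trans (≤-reflexive S≡w) (n≤1+n w))) ⟩
      2           ≤⟨ 2≤w ⟩
      w           ≡⟨ sym S≡w ⟩
      ∣ S ∣       ∎
    ... | tri> _ _ w<S with m≤n⇒m<n∨m≡n w<S
    ... | inj₂ sw≡S = begin
      c + (c + freeIn S) ≤⟨ +-mono-≤ (codewordsIn≤1 S (≤-reflexive (sym sw≡S))) (≤-reflexive one) ⟩
      2                  ≤⟨ ≤-trans 2≤w (<⇒≤ w<S) ⟩
      ∣ S ∣              ∎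
      where
      one : c + freeIn S ≡ 1
      one = trans (cong (_+ freeIn S) (sym (*-identityʳ c)))
        (trans (cong (λ x → c * x + freeIn S) (trans (sym (m+n∸n≡m 1 w)) (cong (_∸ w) sw≡S)))
          (trans (packing S) (trans (cong (_C suc w) (sym sw≡S)) (nCn≡1 (suc w)))))
    ... | inj₁ sw<S = ≤-reflexive (begin-equality
      c + (c + freeIn S)                 ≡⟨ arith c (freeIn S) ⟩
      c * 2 + freeIn S                   ≡⟨ cong (λ x → c * x + freeIn S) (trans (sym (m+n∸n≡m 2 w)) (cong (_∸ w) (sym S≡))) ⟩
      c * (∣ S ∣ ∸ w) + freeIn S         ≡⟨ packing S ⟩
      ∣ S ∣ C suc w                      ≡⟨ cong (_C suc w) S≡ ⟩
      suc (suc w) C suc w                ≡⟨ nCk≡nC[n∸k] (n≤1+n (suc w)) ⟩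
      suc (suc w) C (suc (suc w) ∸ suc w) ≡⟨ cong (suc (suc w) C_) (m+n∸n≡m 1 (suc w)) ⟩
      suc (suc w) C 1                    ≡⟨ nC1≡n (suc (suc w)) ⟩
      suc (suc w)                        ≡⟨ sym S≡ ⟩
      ∣ S ∣                              ∎)
      where
      S≡ : ∣ S ∣ ≡ suc (suc w)
      S≡ = ≤-antisym (s≤s⁻¹ S<k) sw<S
      arith : ∀ c f → c + (c + f) ≡ c * 2 + f
      arith = solve-∀

  CBC-construction : 2 ≤ w → ∀ r → t * (m ∸ w) + r ≤ m C suc w →
    CBCExists (2 * t + r) (2 * t * w + r * suc w) (3 + w) m
  CBC-construction 2≤w r enough = subst₂ (λ x y → CBCExists x y (3 + w) m) size total
    (Sparse⇒CBCExists (family r) (family-sparse 2≤w r))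
    where
    open ≡-Reasoning
    taken : length (take r freeSets) ≡ r
    taken = trans (length-take r freeSets) (m≤n⇒m⊓n≡m
      (+-cancelˡ-≤ (t * (m ∸ w)) r _ (≤-trans enough (≤-reflexive (sym packing-total)))))
    words : length (map D (allFin t)) ≡ t
    words = trans (length-map D (allFin t)) (length-tabulate {n = t} id)
    size : length (family r) ≡ 2 * t + r
    size = trans (length-++ (map D (allFin t)))
      (trans (cong₂ _+_ words (trans (length-++ (map D (allFin t))) (cong₂ _+_ words taken))) (arith t r))
      where
      arith : ∀ t r → t + (t + r) ≡ 2 * t + r
      arith = solve-∀
    ∑-words : ∑ (allFin t) (∣_∣ ∘ D) ≡ t * w
    ∑-words = trans (∑-const (allFin t) (tabulate⁺ (proj₁ code))) (cong (_* w) (length-tabulate {n = t} id))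
    ∑-free : ∑ (take r freeSets) ∣_∣ ≡ r * suc w
    ∑-free = trans (∑-const (take r freeSets) (take⁺ r (All-map proj₁ (all-filter free? (subsets m)))))
      (cong (_* suc w) taken)
    total : ∑ (family r) ∣_∣ ≡ 2 * t * w + r * suc w
    total = begin
      ∑ (family r) ∣_∣                  ≡⟨ ∑-family r ∣_∣ ⟩
      _                                 ≡⟨ cong₂ (λ x y → x + (x + y)) ∑-words ∑-free ⟩
      t * w + (t * w + r * suc w)       ≡⟨ arith t w (r * suc w) ⟩
      2 * t * w + r * suc w             ∎
      where
      arith : ∀ t w x → t * w + (t * w + x) ≡ 2 * t * w + x
      arith = solve-∀

-- Choosing the number of codewords

m∸n≤o⇒m≤n+o : ∀ m n {o} → m ∸ n ≤ o → m ≤ n + o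
m∸n≤o⇒m≤n+o m n m∸n≤o = ≤-trans (m≤n+m∸n m n) (+-monoʳ-≤ n m∸n≤o)

-- The doubled remainder is too small to reach the quotient. This is exactly what makes the lower
-- bound and the construction meet.
[2d]/L≡2[d/L] : ∀ d l → 2 * (d % suc l) < suc l → (2 * d) / suc l ≡ 2 * (d / suc l)
[2d]/L≡2[d/L] d l 2ρ<L = begin
  (2 * d) / L                     ≡⟨ cong (λ x → (2 * x) / L) (m≡m%n+[m/n]*n d L) ⟩
  (2 * (ρ + t * L)) / L           ≡⟨ cong (_/ L) (arith ρ t L) ⟩
  (2 * ρ + 2 * t * L) / L         ≡⟨ +-distrib-/-∣ʳ (2 * ρ) (divides-refl (2 * t)) ⟩
  (2 * ρ) / L + (2 * t * L) / L   ≡⟨ cong₂ _+_ (m<n⇒m/n≡0 2ρ<L) (m*n/n≡m (2 * t) L) ⟩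
  2 * t                           ∎
  where
  open ≡-Reasoning
  L = suc l
  ρ = d % L
  t = d / L
  arith : ∀ ρ t L → 2 * (ρ + t * L) ≡ 2 * ρ + 2 * t * L
  arith = solve-∀

-- Here w = k - 3 and l = m - k, so that the divisor `suc l` = m - k + 1 is visibly nonzero.
module _ {l w m n a : ℕ} (m≡ : m ≡ 3 + w + l) (D : Fin a → Subset m) (code : IsCWCode m 4 w a D)
  (lower : m C suc w ∸ suc l * a ≤ n) (upper : n ≤ m C suc w) where

  private
    L = suc l
    d = m C suc w ∸ n
    ρ = d % L
    t = d / L

    d≡ : d ≡ ρ + t * L
    d≡ = m≡m%n+[m/n]*n d L

    n+d≡ : n + d ≡ m C suc w
    n+d≡ = m+[n∸m]≡n upper

    -- The lower bound on n amounts to d ≤ a L. Hence t codewords are available, and ρ = 0 if all a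
    -- are used.
    ρ+tL≤aL : ρ + t * L ≤ a * L
    ρ+tL≤aL = subst₂ _≤_ d≡ (*-comm L a) (m≤n+o⇒m∸n≤o (m C suc w) n
      (≤-trans (m∸n≤o⇒m≤n+o (m C suc w) (L * a) lower) (≤-reflexive (+-comm (L * a) n))))

    t≤a : t ≤ a
    t≤a = *-cancelʳ-≤ t a L (≤-trans (m≤n+m (t * L) ρ) ρ+tL≤aL)

    m∸w≡ : m ∸ w ≡ 2 + L
    m∸w≡ = trans (cong (_∸ w) (trans m≡ (arith w l))) (m+n∸n≡m (2 + L) w)
      where
      arith : ∀ w l → 3 + w + l ≡ 3 + l + w
      arith = solve-∀

    -- Each codeword has m - w = L + 2 supersets of size w + 1, and these are disjoint for distinct
    -- codewords.
    codewords-pack : ∀ s → s ≤ a → s * (2 + L) ≤ m C suc w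
    codewords-pack s s≤a = subst₂ _≤_ (cong (s *_) m∸w≡)
      (packing-total (λ i → D (inject≤ i s≤a)) (IsCWCode-shorten D s≤a code)) (m≤m+n _ _)

    -- If ρ > 0 then t < a, and the neighbourhood of one more codeword leaves room for ρ sets.
    room : t * (2 + L) + ρ ≤ m C suc w
    room with t <? a
    ... | yes t<a = begin
      t * (2 + L) + ρ         ≤⟨ +-monoʳ-≤ (t * (2 + L)) (≤-trans (<⇒≤ (m%n<n d L)) (m≤n+m L 2)) ⟩
      t * (2 + L) + (2 + L)   ≡⟨ +-comm (t * (2 + L)) (2 + L) ⟩
      suc t * (2 + L)         ≤⟨ codewords-pack (suc t) t<a ⟩
      m C suc w               ∎
      where open ≤-Reasoning
    ... | no t≮a = subst (_≤ m C suc w)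
      (sym (trans (cong (t * (2 + L) +_) ρ≡0) (+-identityʳ (t * (2 + L))))) (codewords-pack t t≤a)
      where
      ρ≡0 : ρ ≡ 0
      ρ≡0 = n≤0⇒n≡0 (+-cancelʳ-≤ (t * L) ρ 0 (≤-trans ρ+tL≤aL (*-monoˡ-≤ L (≮⇒≥ t≮a))))

    -- This is `room` with d cancelled; it makes n - 2t, the number of free sets to take, a true
    -- difference.
    2t≤n : 2 * t ≤ n
    2t≤n = +-cancelʳ-≤ d (2 * t) n (begin
      2 * t + d             ≡⟨ cong (2 * t +_) d≡ ⟩
      2 * t + (ρ + t * L)   ≡⟨ arith t ρ L ⟩
      t * (2 + L) + ρ       ≤⟨ room ⟩
      m C suc w             ≡⟨ sym n+d≡ ⟩
      n + d                 ∎)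
      where
      open ≤-Reasoning
      arith : ∀ t ρ L → 2 * t + (ρ + t * L) ≡ t * (2 + L) + ρ
      arith = solve-∀

  2t≤n[k-2] : 2 * t ≤ n * suc w
  2t≤n[k-2] = ≤-trans 2t≤n (m≤m*n n (suc w))

  -- Each of the 2t doubled codewords is one smaller than a (k - 2)-set. No condition on ρ is
  -- imposed, so both halves of the theorem draw on it.
  CBC-upper : 2 ≤ w → CBCExists n (n * suc w ∸ 2 * t) (3 + w) m
  CBC-upper 2≤w = subst₂ (λ x y → CBCExists x y (3 + w) m) 2t+r≡n total
    (CBC-construction (λ i → D (inject≤ i t≤a)) (IsCWCode-shorten D t≤a code) 2≤w r enough)
    where
    r = n ∸ 2 * t
    2t+r≡n : 2 * t + r ≡ n
    2t+r≡n = m+[n∸m]≡n 2t≤n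
    enough : t * (m ∸ w) + r ≤ m C suc w
    enough = begin
      t * (m ∸ w) + r       ≡⟨ cong (λ x → t * x + r) m∸w≡ ⟩
      t * (2 + L) + r       ≡⟨ arith t L r ⟩
      2 * t + r + t * L     ≡⟨ cong (_+ t * L) 2t+r≡n ⟩
      -- The slack is ρ: exactly that many free sets stay out of the family.
      n + t * L             ≤⟨ +-monoʳ-≤ n (≤-trans (m≤n+m (t * L) ρ) (≤-reflexive (sym d≡))) ⟩
      n + d                 ≡⟨ n+d≡ ⟩
      m C suc w             ∎
      where
      open ≤-Reasoning
      arith : ∀ t L r → t * (2 + L) + r ≡ 2 * t + r + t * L
      arith = solve-∀
    total : 2 * t * w + r * suc w ≡ n * suc w ∸ 2 * t
    total = begin
      2 * t * w + r * suc w                   ≡⟨ sym (m+n∸n≡m _ (2 * t)) ⟩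
      2 * t * w + r * suc w + 2 * t ∸ 2 * t   ≡⟨ cong (_∸ 2 * t) (arith (2 * t) w r) ⟩
      (2 * t + r) * suc w ∸ 2 * t             ≡⟨ cong (λ x → x * suc w ∸ 2 * t) 2t+r≡n ⟩
      n * suc w ∸ 2 * t                       ∎
      where
      open ≡-Reasoning
      arith : ∀ x w r → x * w + r * suc w + x ≡ (x + r) * suc w
      arith = solve-∀

  -- `CBC-lower` with C(m,k-2) = n + d loses 2n on both sides and leaves L (n(k - 2) - N) ≤ 2d;
  -- integrality of N allows the floor.
  CBC-lower-/ : ∀ N → CBCExists n N (3 + w) m → n * suc w ∸ (2 * d) / L ≤ N
  CBC-lower-/ N (X , cbc , refl) = m≤n+o⇒m∸n≤o (n * suc w) ((2 * d) / L)
    (≤-trans (m∸n≤o⇒m≤n+o (n * suc w) N deficit) (≤-reflexive (+-comm N ((2 * d) / L))))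
    where
    open ≤-Reasoning
    arith₁ : ∀ L x n → 2 * n + x * L ≡ n * 2 + L * x
    arith₁ = solve-∀
    arith₂ : ∀ n L w → n * 2 + L * (n * suc w) ≡ n * (2 + L * suc w)
    arith₂ = solve-∀
    arith₃ : ∀ n d L N → 2 * (n + d) + L * N ≡ 2 * n + (N * L + 2 * d)
    arith₃ = solve-∀
    m≡′ : m ≡ suc l + suc (suc w)
    m≡′ = trans m≡ (arith w l)
      where
      arith : ∀ w l → 3 + w + l ≡ suc l + suc (suc w)
      arith = solve-∀
    scaled : n * suc w * L ≤ N * L + 2 * d
    scaled = +-cancelˡ-≤ (2 * n) _ _ (begin
      2 * n + n * suc w * L         ≡⟨ arith₁ L (n * suc w) n ⟩
      n * 2 + L * (n * suc w)       ≡⟨ arith₂ n L w ⟩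
      n * (2 + L * suc w)           ≤⟨ CBC-lower l (suc w) m≡′ X cbc ⟩
      2 * (m C suc w) + L * N       ≡⟨ cong (λ x → 2 * x + L * N) (sym n+d≡) ⟩
      2 * (n + d) + L * N           ≡⟨ arith₃ n d L N ⟩
      2 * n + (N * L + 2 * d)       ∎)
    deficit : n * suc w ∸ N ≤ (2 * d) / L
    deficit = begin
      n * suc w ∸ N                 ≡⟨ sym (m*n/n≡m (n * suc w ∸ N) L) ⟩
      ((n * suc w ∸ N) * L) / L     ≤⟨ /-monoˡ-≤ L (≤-trans (≤-reflexive (*-distribʳ-∸ L (n * suc w) N))
                                         (m≤n+o⇒m∸n≤o (n * suc w * L) (N * L) scaled)) ⟩
      (2 * d) / L                   ∎

-- The last component of each half shows that truncated subtraction in the value is genuine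
-- subtraction. The threshold on ρ is doubled to avoid fractions.
theorem3p6 : (k m n a : ℕ) → 5 ≤ k → k ≤ m → AValue m 4 (k ∸ 3) a →
    (m C (k ∸ 2)) ∸ (suc (m ∸ k)) * a ≤ n → n ≤ m C (k ∸ 2) →
    (2 * (((m C (k ∸ 2)) ∸ n) % suc (m ∸ k)) < suc (m ∸ k) →
    NValue n k m (n * (k ∸ 2) ∸ (2 * ((m C (k ∸ 2)) ∸ n)) / suc (m ∸ k))
    × ((2 * ((m C (k ∸ 2)) ∸ n)) / suc (m ∸ k) ≤ n * (k ∸ 2)))
    × (suc (m ∸ k) ≤ 2 * (((m C (k ∸ 2)) ∸ n) % suc (m ∸ k)) →
    NAtMost n k m (n * (k ∸ 2) ∸ 2 * (((m C (k ∸ 2)) ∸ n) / suc (m ∸ k)))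
    × (2 * (((m C (k ∸ 2)) ∸ n) / suc (m ∸ k)) ≤ n * (k ∸ 2)))
theorem3p6 (suc (suc (suc w))) m n a (s≤s (s≤s (s≤s 2≤w))) k≤m ((D , code) , _) lower upper =
  (λ 2ρ<L → let q≡2t = [2d]/L≡2[d/L] (m C suc w ∸ n) (m ∸ (3 + w)) 2ρ<L in
    ( subst (λ q → CBCExists n (n * suc w ∸ q) (3 + w) m) (sym q≡2t) construction
    , CBC-lower-/ m≡ D code lower upper )
    , subst (_≤ n * suc w) (sym q≡2t) small)
  , (λ _ → (_ , construction , ≤-refl) , small)
  where
  m≡ : m ≡ 3 + w + (m ∸ (3 + w))
  m≡ = sym (m+[n∸m]≡n k≤m)
  construction = CBC-upper m≡ D code lower upper 2≤w
  small = 2t≤n[k-2] m≡ D code lower upper
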